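{- There exists an absolute constant $C>0$ such that for every positive integer $t$ and every finite graph $G$ of cliquewidth at most $t$, the hypergraph of balls in $G$ has a proper sample compression scheme of size at most $C\,t\log(t+1)$ (i.e. of size $\mathcal{O}(t\log t)$).
   Context: A hypergraph $H$ is a pair $(V(H),E(H))$ with $V(H)$ finite and $E(H)$ a set of subsets of $V(H)$. A sample of $H$ is a pair $(X^+,X^-)$ of subsets of $V(H)$ such that some $e\in E(H)$ satisfies $X^+\subseteq e$, $X^-\cap e=\emptyset$; $\mathcal{S}(H)$ denotes the set of samples. $S\subseteq V(H)$ realizes $(X^+,X^-)$ if $X^+\subseteq S$ and $S\cap X^-=\emptyset$. A subsample of $(X^+,X^-)$ is a sample $(Y^+,Y^-)$ with $Y^\pm\subseteq X^\pm$; its size is $|Y^+\cup Y^-|$. A sample compression scheme is a pair $(\kappa,\rho)$, $\kappa:\mathcal{S}(H)\to\mathcal{S}(H)\times\{0,1\}^*$, $\rho:\mathcal{S}(H)\times\{0,1\}^*\to 2^{V(H)}$, such that for every sample, the first component of $\kappa(X^+,X^-)$ is a subsample of $(X^+,X^-)$ and $\rho(\kappa(X^+,X^-))$ realizes $(X^+,X^-)$. Its size is $k_1+k_2$ where $k_1$ is the maximum size of the subsample and $k_2$ the maximum length of the bitstring output by $\kappa$. It is proper if all values of $\rho$ are hyperedges. For a graph $G$, $B_G(c,r)=\{v:\mathrm{dist}_G(c,v)\le r\}$ (shortest-path distance); the hypergraph of balls in $G$ has vertex set $V(G)$ and hyperedges all $B_G(c,r)$, $c\in V(G)$, $r$ an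 integer. The cliquewidth of $G$ is the minimum $k$ such that $G$ can be built using labels in $[k]$ by the operations: create a single vertex with a label; disjoint union; for labels $i\neq j$, add all edges between vertices labeled $i$ and vertices labeled $j$; relabel all vertices with label $i$ to label $j$. -}

module Defs where

open import Level using (0ℓ)
open import Data.Bool.Base using (Bool; if_then_else_)
import Data.Empty as Empty
open import Data.Fin.Base using (Fin; splitAt)
open import Data.Fin.Properties using (_≟_)
open import Data.Fin.Subset using (Subset; _∈_; _⊆_; _∩_; _∪_; ∣_∣; ⊥)
open import Data.Integer.Base as ℤ using (ℤ; +_)
open import Data.List.Base using (List; length)
open import Data.Nat.Base using (ℕ; zero; suc; _+_; _≤_)
open import Data.Product.Base using (Σ; ∃-syntax; _×_; _,_; proj₁; proj₂)
open import Data.Sum.Base using (_⊎_; inj₁; inj₂; [_,_]′)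
open import Data.Sum.Relation.Binary.Pointwise as ⊎ using (Pointwise)
open import Function.Base using (_on_)
open import Function.Bundles using (_↔_; _⇔_; module Inverse)
open import Relation.Binary.Core using (Rel)
open import Relation.Binary.Definitions using (Decidable; Symmetric; Irreflexive)
open import Relation.Binary.PropositionalEquality using (_≡_; _≢_; refl; sym; trans; cong)
open import Relation.Nullary using (no)
open import Relation.Nullary.Decidable using (does; _×-dec_; _⊎-dec_)
open import Relation.Unary using (Pred)

------------------------------------------------------------------------
-- Hypergraphs and samples

record Hypergraph : Set₁ where
  field
    order       : ℕ
    IsHyperedge : Pred (Subset order) 0ℓ

-- The proof of sample-hood is irrelevant: a sample is just the pair
-- (X⁺ , X⁻), so a reconstructor cannot read off the witnessing hyperedge.
record Sample (H : Hypergraph) : Set where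
  open Hypergraph H
  field
    pos neg   : Subset order
    .isSample : ∃[ e ] IsHyperedge e × pos ⊆ e × neg ∩ e ≡ ⊥

module _ {H : Hypergraph} where
  open Hypergraph H
  open Sample

  size : Sample H → ℕ
  size X = ∣ pos X ∪ neg X ∣

  Realizes : Subset order → Sample H → Set
  Realizes S X = pos X ⊆ S × S ∩ neg X ≡ ⊥

  Subsample : Sample H → Sample H → Set
  Subsample Y X = pos Y ⊆ pos X × neg Y ⊆ neg X

------------------------------------------------------------------------
-- Sample compression schemes

record CompressionScheme (H : Hypergraph) : Set where
  open Hypergraph H
  field
    κ           : Sample H → Sample H × List Bool
    ρ           : Sample H × List Bool → Subset order
    κ-subsample : ∀ X → Subsample (proj₁ (κ X)) X
    ρ-realizes  : ∀ X → Realizes (ρ (κ X)) X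

IsMaximum : {A : Set} → (A → ℕ) → ℕ → Set
IsMaximum f k = (∀ x → f x ≤ k) × (∃[ x ] f x ≡ k)

module _ {H : Hypergraph} (𝒞 : CompressionScheme H) where
  open Hypergraph H
  open CompressionScheme 𝒞

  HasSize : ℕ → Set
  HasSize s = ∃[ k₁ ] ∃[ k₂ ]
      IsMaximum (λ X → size (proj₁ (κ X))) k₁
    × IsMaximum (λ X → length (proj₂ (κ X))) k₂
    × s ≡ k₁ + k₂

  Proper : Set
  Proper = ∀ Yb → IsHyperedge (ρ Yb)

------------------------------------------------------------------------
-- Finite simple graphs

record Graph (n : ℕ) : Set₁ where
  field
    Adj    : Rel (Fin n) 0ℓ
    adj?   : Decidable Adj
    symm   : Symmetric Adj
    irrefl : Irreflexive _≡_ Adj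

open Graph public

record _≅_ {m n : ℕ} (G : Graph m) (H : Graph n) : Set where
  field
    vertices : Fin m ↔ Fin n
    edges    : ∀ u v → Adj G u v ⇔ Adj H (Inverse.to vertices u) (Inverse.to vertices v)

------------------------------------------------------------------------
-- Distances and balls

module _ {n : ℕ} (G : Graph n) where

  data Walk : Fin n → Fin n → ℕ → Set where
    []  : ∀ {u} → Walk u u zero
    _∷_ : ∀ {u v w l} → Adj G u v → Walk v w l → Walk u w (suc l)

  -- A walk of minimum length never repeats a vertex, so this is the length
  -- of a shortest path.  Vertices in distinct components have no distance.
  IsDist : Fin n → Fin n → ℕ → Set
  IsDist u v d = Walk u v d × (∀ l → Walk u v l → d ≤ l)

  -- A negative radius gives the empty ball.
  IsBall : Fin n → ℤ → Subset n → Set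
  IsBall c r S = ∀ v → v ∈ S ⇔ (∃[ d ] IsDist c v d × + d ℤ.≤ r)

  balls : Hypergraph
  balls = record
    { order       = n
    ; IsHyperedge = λ S → ∃[ c ] ∃[ r ] IsBall c r S
    }

------------------------------------------------------------------------
-- Cliquewidth

record LabelledGraph (k n : ℕ) : Set₁ where
  field
    graph : Graph n
    label : Fin n → Fin k

open LabelledGraph public

module _ {k : ℕ} where

  singleᴸ : Fin k → LabelledGraph k 1
  singleᴸ i = record
    { graph = record
      { Adj    = λ _ _ → Empty.⊥
      ; adj?   = λ _ _ → no λ ()
      ; symm   = λ ()
      ; irrefl = λ _ ()
      }
    ; label = λ _ → i
    }

  -- The first m vertices are those of G, the last n those of H.
  disjointUnionᴸ : ∀ {m n} → LabelledGraph k m → LabelledGraph k n → LabelledGraph k (m + n)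
  disjointUnionᴸ {m} G H = record
    { graph = record
      { Adj    = Pointwise (Adj (graph G)) (Adj (graph H)) on splitAt m
      ; adj?   = λ u v → ⊎.⊎-decidable (adj? (graph G)) (adj? (graph H)) (splitAt m u) (splitAt m v)
      ; symm   = ⊎.⊎-symmetric (symm (graph G)) (symm (graph H))
      ; irrefl = λ u≡v → ⊎.⊎-irreflexive (irrefl (graph G)) (irrefl (graph H))
                           (⊎.≡⇒Pointwise-≡ (cong (splitAt m) u≡v))
      }
    ; label = λ v → [ label G , label H ]′ (splitAt m v)
    }

  joinᴸ : ∀ {n} (i j : Fin k) → i ≢ j → LabelledGraph k n → LabelledGraph k n
  joinᴸ i j i≢j G = record
    { graph = record
      { Adj    = λ u v → Adj (graph G) u v
                       ⊎ (label G u ≡ i × label G v ≡ j)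
                       ⊎ (label G u ≡ j × label G v ≡ i)
      ; adj?   = λ u v → adj? (graph G) u v
                   ⊎-dec (label G u ≟ i ×-dec label G v ≟ j)
                   ⊎-dec (label G u ≟ j ×-dec label G v ≟ i)
      ; symm   = λ where
          (inj₁ uv)              → inj₁ (symm (graph G) uv)
          (inj₂ (inj₁ (ui , vj))) → inj₂ (inj₂ (vj , ui))
          (inj₂ (inj₂ (uj , vi))) → inj₂ (inj₁ (vi , uj))
      ; irrefl = λ where
          u≡v  (inj₁ uv)              → irrefl (graph G) u≡v uv
          refl (inj₂ (inj₁ (ui , uj))) → i≢j (trans (sym ui) uj)
          refl (inj₂ (inj₂ (uj , ui))) → i≢j (trans (sym ui) uj)
      }
    ; label = label G
    }

  relabelᴸ : ∀ {n} → Fin k → Fin k → LabelledGraph k n → LabelledGraph k n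
  relabelᴸ i j G = record
    { graph = graph G
    ; label = λ v → if does (label G v ≟ i) then j else label G v
    }

data Expr (k : ℕ) : ℕ → Set where
  single        : Fin k → Expr k 1
  disjointUnion : ∀ {m n} → Expr k m → Expr k n → Expr k (m + n)
  join          : ∀ {n} (i j : Fin k) → i ≢ j → Expr k n → Expr k n
  relabel       : ∀ {n} → Fin k → Fin k → Expr k n → Expr k n

⟦_⟧ : ∀ {k n} → Expr k n → LabelledGraph k n
⟦ single i ⟧          = singleᴸ i
⟦ disjointUnion e f ⟧ = disjointUnionᴸ ⟦ e ⟧ ⟦ f ⟧
⟦ join i j i≢j e ⟧    = joinᴸ i j i≢j ⟦ e ⟧
⟦ relabel i j e ⟧     = relabelᴸ i j ⟦ e ⟧

BuildableWith : ∀ {n} → Graph n → ℕ → Set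
BuildableWith G k = ∃[ m ] Σ (Expr k m) λ e → graph ⟦ e ⟧ ≅ G

-- The graph without vertices has no cliquewidth, as no operation creates it.
IsCliquewidth : ∀ {n} → Graph n → ℕ → Set
IsCliquewidth G k = BuildableWith G k × (∀ j → BuildableWith G j → k ≤ j)

{-# OPTIONS --safe #-}

-- A node of a cliquewidth expression is a vertex set with at most k label
-- classes, and vertices of one class are twins towards the outside.  Distances
-- across its boundary hence split as a minimum over the k classes of a part
-- depending on the inner vertex plus a part depending on the outer one.
-- Given a sample and a realizing ball B(c, r) with c not in the sample, climb
-- from the leaf of c: there are nodes P and Q with c in P but not in Q such that
-- every sample vertex in P lies in Q, where Q is the lowest common ancestor of two
-- sample vertices x, y and P is the root or the child, on the side of x, of the
-- lowest common ancestor of x and a third sample vertex.  So each sample vertex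
-- is separated from c by P or by Q, and for each of the 2k classes it suffices to
-- keep the furthest positive vertex reached through that class and the nearest
-- negative one.  Any centre in P \ Q and radius consistent with these 4k + 3
-- vertices realizes the whole sample.  The bits record which kept vertex plays
-- which role, O(log k) bits per role.
module Submission where

open import Defs
open import Level using (0ℓ)
open import Data.Bool.Base using (Bool; if_then_else_)
open import Data.Fin.Base as Fin using (Fin; zero; suc; toℕ; fromℕ<; splitAt; _↑ˡ_; _↑ʳ_; combine; remQuot; finToFun; funToFin)
open import Data.Fin.Patterns using (0F; 1F; 2F)
open import Data.Fin.Properties as Fin using (any?; all?; 2↔Bool)
open import Data.Fin.Subset using (Subset; _∈_; _∉_; _⊆_; _∩_; _∪_; ∣_∣; ⊥; ⁅_⁆; inside; outside)
open import Data.Fin.Subset.Properties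
open import Data.Integer.Base using (+_; -[1+_]; +≤+)
open import Data.List.Base as List using (List; []; _∷_; length)
open import Data.List.Properties using (length-map; length-tabulate)
open import Data.Maybe.Base using (Maybe; just; nothing)
open import Data.Maybe.Relation.Unary.All as All using (All; just; nothing)
open import Data.Nat.Base
open import Data.Nat.Induction using (<-rec)
open import Data.Nat.Logarithm using (⌊log₂_⌋; ⌊log₂⌋-mono-≤; ⌊log₂⌊n/2⌋⌋≡⌊log₂n⌋∸1)
open import Data.Nat.Properties
open import Data.Nat.Solver using (module +-*-Solver)
open import Data.Product.Base using (Σ; ∃; ∃-syntax; _×_; _,_; proj₁; proj₂)
open import Data.Sum.Base using (_⊎_; inj₁; inj₂; [_,_]; swap)
import Data.Sum.Relation.Binary.Pointwise as ⊎
open import Data.Vec.Base as Vec using ([]; _∷_)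
open import Data.Vec.Properties using ([]=⇒lookup; lookup⇒[]=; lookup∘tabulate)
open import Data.Empty using (⊥-elim)
open import Function.Base using (_∘_)
open import Function.Bundles using (_⇔_; mk⇔; Inverse; Equivalence)
open import Relation.Binary.Core using (Rel)
open import Relation.Binary.Definitions using (Reflexive; Total; Transitive)
open import Relation.Binary.PropositionalEquality using (_≡_; refl; sym; trans; cong; cong₂; subst)
open import Relation.Nullary using (¬_; Dec; yes; no; contradiction)
open import Relation.Nullary.Decidable using (does; map′; _×-dec_; _⊎-dec_; _→-dec_; ¬?; dec-true; dec-false; recompute)
open import Relation.Unary using (Pred; Decidable)

open +-*-Solver using (solve; _:=_; con; _:+_; _:*_)
open Equivalence using (to; from)
open Hypergraph
open Sample
open CompressionScheme

-- Bounded searches and maxima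

-- The bound `b` doubles as the value for failure, so a result below `b` is a genuine solution.
least : ∀ {P : Pred ℕ 0ℓ} → Decidable P → ℕ → ℕ
least P? zero    = zero
least P? (suc b) with P? 0
... | yes _ = 0
... | no  _ = suc (least (P? ∘ suc) b)

least-satisfies : ∀ {P : Pred ℕ 0ℓ} (P? : Decidable P) b → least P? b < b → P (least P? b)
least-satisfies P? (suc b) l<b with P? 0
... | yes p = p
... | no  _ = least-satisfies (P? ∘ suc) b (s≤s⁻¹ l<b)

least-≤ : ∀ {P : Pred ℕ 0ℓ} (P? : Decidable P) b {l} → P l → least P? b ≤ l
least-≤ P? zero    p = z≤n
least-≤ P? (suc b) p with P? 0
least-≤ P? (suc b)         p | yes _ = z≤n
least-≤ P? (suc b) {zero}  p | no ¬p = contradiction p ¬p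
least-≤ P? (suc b) {suc l} p | no _  = s≤s (least-≤ (P? ∘ suc) b p)

Greatest : ∀ {n} → Pred (Fin n) 0ℓ → Rel (Fin n) 0ℓ → Maybe (Fin n) → Set
Greatest P _≲_ nothing  = ∀ x → ¬ P x
Greatest P _≲_ (just y) = P y × (∀ x → P x → x ≲ y)

greatest : ∀ {n} {P : Pred (Fin n) 0ℓ} → Decidable P →
           (_≲_ : Rel (Fin n) 0ℓ) → Reflexive _≲_ → Total _≲_ → Transitive _≲_ → ∃ (Greatest P _≲_)
greatest {zero}  P? _≲_ rfl total tr = nothing , λ ()
greatest {suc n} P? _≲_ rfl total tr
  with P? zero | greatest (P? ∘ suc) (λ x y → suc x ≲ suc y) rfl (λ x y → total (suc x) (suc y)) tr
... | no ¬p | nothing , ¬q       = nothing , λ { zero → ¬p ; (suc x) → ¬q x }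
... | no ¬p | just y  , (q , ub) = just (suc y) , q , λ { zero p → contradiction p ¬p ; (suc x) → ub x }
... | yes p | nothing , ¬q       = just zero , p , λ { zero _ → rfl ; (suc x) q → contradiction q (¬q x) }
... | yes p | just y  , (q , ub) with total zero (suc y)
...   | inj₁ 0≲y = just (suc y) , q , λ { zero _ → 0≲y ; (suc x) → ub x }
...   | inj₂ y≲0 = just zero , p , λ { zero _ → rfl ; (suc x) q′ → tr (ub x q′) y≲0 }

-- Descending from the bound, the first attained value is the maximum. This yields the attained
-- maximum that `IsMaximum` demands.
bounded⇒maximum : ∀ {A : Set} (f : A → ℕ) → (∀ k → Dec (∃[ a ] f a ≡ k)) →
                  A → ∀ b → (∀ a → f a ≤ b) → ∃[ k ] k ≤ b × IsMaximum f k
bounded⇒maximum f hit? a zero    ub = 0 , z≤n , ub , a , n≤0⇒n≡0 (ub a)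
bounded⇒maximum f hit? a (suc b) ub with hit? (suc b)
... | yes hit = suc b , ≤-refl , ub , hit
... | no ¬hit with bounded⇒maximum f hit? a b
                     (λ x → s≤s⁻¹ (≤∧≢⇒< (ub x) λ eq → ¬hit (x , eq)))
...   | k , k≤b , max = k , m≤n⇒m≤1+n k≤b , max

-- Subsets

subset : ∀ {n} {P : Pred (Fin n) 0ℓ} → Decidable P → Subset n
subset P? = Vec.tabulate (does ∘ P?)

∈-subset⁺ : ∀ {n} {P : Pred (Fin n) 0ℓ} (P? : Decidable P) {v} → P v → v ∈ subset P?
∈-subset⁺ P? {v} p = lookup⇒[]= v _ (trans (lookup∘tabulate _ v) (dec-true (P? v) p))

∈-subset⁻ : ∀ {n} {P : Pred (Fin n) 0ℓ} (P? : Decidable P) {v} → v ∈ subset P? → P v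
∈-subset⁻ P? {v} v∈ with P? v in eq
... | yes p = p
... | no ¬p with () ← trans (sym ([]=⇒lookup v∈)) (trans (lookup∘tabulate _ v) (cong does eq))

∩≡⊥⁺ : ∀ {n} {p q : Subset n} → (∀ {x} → x ∈ p → x ∉ q) → p ∩ q ≡ ⊥
∩≡⊥⁺ {p = p} {q} disj = Empty-unique λ (x , x∈) → let a , b = x∈p∩q⁻ p q x∈ in disj a b

∩≡⊥⁻ : ∀ {n} {p q : Subset n} → p ∩ q ≡ ⊥ → ∀ {x} → x ∈ p → x ∉ q
∩≡⊥⁻ eq x∈p x∈q = ∉⊥ (subst (_ ∈_) eq (x∈p∩q⁺ (x∈p , x∈q)))

∣p∪q∣≤∣p∣+∣q∣ : ∀ {n} (p q : Subset n) → ∣ p ∪ q ∣ ≤ ∣ p ∣ + ∣ q ∣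
∣p∪q∣≤∣p∣+∣q∣ []            []            = z≤n
∣p∪q∣≤∣p∣+∣q∣ (outside ∷ p) (outside ∷ q) = ∣p∪q∣≤∣p∣+∣q∣ p q
∣p∪q∣≤∣p∣+∣q∣ (outside ∷ p) (inside  ∷ q) = ≤-trans (s≤s (∣p∪q∣≤∣p∣+∣q∣ p q)) (≤-reflexive (sym (+-suc ∣ p ∣ ∣ q ∣)))
∣p∪q∣≤∣p∣+∣q∣ (inside  ∷ p) (outside ∷ q) = s≤s (∣p∪q∣≤∣p∣+∣q∣ p q)
∣p∪q∣≤∣p∣+∣q∣ (inside  ∷ p) (inside  ∷ q) = s≤s (≤-trans (∣p∪q∣≤∣p∣+∣q∣ p q) (+-monoʳ-≤ ∣ p ∣ (n≤1+n ∣ q ∣)))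

fromMaybe : ∀ {n} → Maybe (Fin n) → Subset n
fromMaybe nothing  = ⊥
fromMaybe (just v) = ⁅ v ⁆

∣fromMaybe∣≤1 : ∀ {n} (m : Maybe (Fin n)) → ∣ fromMaybe m ∣ ≤ 1
∣fromMaybe∣≤1 {n} nothing  = ≤-trans (≤-reflexive (∣⊥∣≡0 n)) z≤n
∣fromMaybe∣≤1     (just v) = ≤-reflexive (∣⁅x⁆∣≡1 v)

Within : ∀ {n L} → Subset n → (Fin L → Maybe (Fin n)) → Set
Within X g = ∀ j {v} → g j ≡ just v → v ∈ X

range : ∀ {n L} → (Fin L → Maybe (Fin n)) → Subset n
range {L = zero}  g = ⊥
range {L = suc L} g = fromMaybe (g zero) ∪ range (g ∘ suc)

∣range∣≤ : ∀ {n L} (g : Fin L → Maybe (Fin n)) → ∣ range g ∣ ≤ L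
∣range∣≤ {n} {zero}  g = ≤-reflexive (∣⊥∣≡0 n)
∣range∣≤     {L = suc L} g =
  ≤-trans (∣p∪q∣≤∣p∣+∣q∣ (fromMaybe (g zero)) _) (+-mono-≤ (∣fromMaybe∣≤1 (g zero)) (∣range∣≤ (g ∘ suc)))

∈-range : ∀ {n L} (g : Fin L → Maybe (Fin n)) → Within (range g) g
∈-range g zero    {v} eq = x∈p∪q⁺ (inj₁ (subst (λ m → v ∈ fromMaybe m) (sym eq) (x∈⁅x⁆ v)))
∈-range g (suc j) eq = x∈p∪q⁺ {p = fromMaybe (g zero)} (inj₂ (∈-range (g ∘ suc) j eq))

-- Bit strings

nth : ∀ {A : Set} → List A → ℕ → Maybe A
nth []       _       = nothing
nth (x ∷ xs) zero    = just x
nth (x ∷ xs) (suc i) = nth xs i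

nth-length : ∀ {A : Set} (xs : List A) {i} → length xs ≤ i → nth xs i ≡ nothing
nth-length []       _ = refl
nth-length (x ∷ xs) (s≤s le) = nth-length xs le

nth-map : ∀ {A B : Set} (f : A → B) xs i {x} → nth xs i ≡ just x → nth (List.map f xs) i ≡ just (f x)
nth-map f (x ∷ xs) zero    refl = refl
nth-map f (x ∷ xs) (suc i) eq   = nth-map f xs i eq

nth-tabulate : ∀ {A : Set} {m} (f : Fin m → A) i → nth (List.tabulate f) (toℕ i) ≡ just (f i)
nth-tabulate f zero    = refl
nth-tabulate f (suc i) = nth-tabulate (f ∘ suc) i

elements : ∀ {n} → Subset n → List (Fin n)
elements []            = []
elements (inside  ∷ p) = zero ∷ List.map suc (elements p)
elements (outside ∷ p) = List.map suc (elements p)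

length-elements : ∀ {n} (p : Subset n) → length (elements p) ≡ ∣ p ∣
length-elements []            = refl
length-elements (inside  ∷ p) = cong suc (trans (length-map suc (elements p)) (length-elements p))
length-elements (outside ∷ p) = trans (length-map suc (elements p)) (length-elements p)

nth-elements : ∀ {n} (p : Subset n) {v} → v ∈ p → ∃[ i ] i < ∣ p ∣ × nth (elements p) i ≡ just v
nth-elements (inside ∷ p) Vec.here = 0 , z<s , refl
nth-elements (inside  ∷ p) (Vec.there v∈p) with nth-elements p v∈p
... | i , i< , eq = suc i , s<s i< , nth-map suc (elements p) i eq
nth-elements (outside ∷ p) (Vec.there v∈p) with nth-elements p v∈p
... | i , i< , eq = i , i< , nth-map suc (elements p) i eq

funToFin-cong : ∀ {m n} {f g : Fin m → Fin n} → (∀ i → f i ≡ g i) → funToFin f ≡ funToFin g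
funToFin-cong {zero}  f≗g = refl
funToFin-cong {suc m} f≗g = cong₂ combine (f≗g zero) (funToFin-cong (f≗g ∘ suc))

-- A missing bit counts as 0, so that strings of any length can be unpacked: `ρ` has to be total.
bit : Maybe Bool → Fin 2
bit nothing  = zero
bit (just b) = Inverse.from 2↔Bool b

pack : ∀ {L w} → (Fin L → Fin (2 ^ w)) → List Bool
pack {L} {w} c = List.tabulate {n = L * w} λ q →
  let j , i = remQuot {L} w q in Inverse.to 2↔Bool (finToFun {2} {w} (c j) i)

unpack : ∀ {L} w → List Bool → Fin L → Fin (2 ^ w)
unpack w bs j = funToFin {w} λ i → bit (nth bs (toℕ (combine j i)))

length-pack : ∀ {L w} (c : Fin L → Fin (2 ^ w)) → length (pack {L} {w} c) ≡ L * w
length-pack {L} {w} c = length-tabulate {n = L * w} _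

unpack-pack : ∀ {L w} (c : Fin L → Fin (2 ^ w)) j → unpack w (pack {L} {w} c) j ≡ c j
unpack-pack {L} {w} c j = trans (funToFin-cong bits) (Fin.funToFin-finToFin {w} (c j))
  where
    bits : ∀ i → bit (nth (pack {L} {w} c) (toℕ (combine j i))) ≡ finToFun {2} {w} (c j) i
    bits i = trans (cong bit (nth-tabulate {m = L * w} _ (combine j i)))
      (trans (cong (λ ji → Inverse.from 2↔Bool (Inverse.to 2↔Bool (finToFun {2} {w} (c (proj₁ ji)) (proj₂ ji))))
                   (Fin.remQuot-combine {L} j i))
             (Inverse.strictlyInverseʳ 2↔Bool _))

-- A vertex is named by its rank in `Y`, which the reconstructor sees too. A name therefore costs
-- `w` bits whatever the size of the graph.
recall : ∀ {n L} w → Subset n → List Bool → Fin L → Maybe (Fin n)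
recall w Y bs j = nth (elements Y) (toℕ (unpack w bs j))

-- The out-of-range position ∣ Y ∣ encodes nothing.
memorise : ∀ {n L} w (Y : Subset n) → ∣ Y ∣ < 2 ^ w →
           (g : Fin L → Maybe (Fin n)) → Within Y g →
           ∃[ bs ] length bs ≡ L * w × (∀ j → recall w Y bs j ≡ g j)
memorise {n} {L} w Y fits g g∈Y =
  pack {L} {w} (proj₁ ∘ code) , length-pack {L} {w} (proj₁ ∘ code) , λ j →
    trans (cong (nth (elements Y) ∘ toℕ) (unpack-pack {L} {w} (proj₁ ∘ code) j)) (proj₂ (code j))
  where
    position : ∀ m → (∀ {v} → m ≡ just v → v ∈ Y) → ∃[ i ] i ≤ ∣ Y ∣ × nth (elements Y) i ≡ m
    position nothing  _  = ∣ Y ∣ , ≤-refl , nth-length (elements Y) (≤-reflexive (length-elements Y))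
    position (just v) v∈ = let i , i< , eq = nth-elements Y (v∈ refl) in i , <⇒≤ i< , eq

    code : ∀ j → ∃[ c ] nth (elements Y) (toℕ {2 ^ w} c) ≡ g j
    code j = let i , i≤ , eq = position (g j) (g∈Y j)
                 i< = ≤-<-trans i≤ fits
             in fromℕ< i< , trans (cong (nth (elements Y)) (Fin.toℕ-fromℕ< i<)) eq

-- Distances

module _ {n : ℕ} (G : Graph n) where

  _++ʷ_ : ∀ {u v w l m} → Walk G u v l → Walk G v w m → Walk G u w (l + m)
  []      ++ʷ q = q
  (e ∷ p) ++ʷ q = e ∷ (p ++ʷ q)

  reverseʷ : ∀ {u v l} → Walk G u v l → Walk G v u l
  reverseʷ [] = []
  reverseʷ {u} {v} {suc l} (e ∷ p) = subst (Walk G v u) (+-comm l 1) (reverseʷ p ++ʷ (symm G e ∷ []))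

  walk? : ∀ u v → Decidable (Walk G u v)
  walk? u v zero = map′ (λ { refl → [] }) (λ { [] → refl }) (u Fin.≟ v)
  walk? u v (suc l) =
    map′ (λ (w , e , p) → e ∷ p) (λ { (e ∷ p) → _ , e , p }) (any? λ w → adj? G u w ×-dec walk? w v l)

  vertexAt : ∀ {u v l} → Walk G u v l → Fin (suc l) → Fin n
  vertexAt {u} p       zero    = u
  vertexAt     (e ∷ p) (suc i) = vertexAt p i

  before : ∀ {u v l} (p : Walk G u v l) i → Walk G u (vertexAt p i) (toℕ i)
  before p       zero    = []
  before (e ∷ p) (suc i) = e ∷ before p i

  after : ∀ {u v l} (p : Walk G u v l) i → Walk G (vertexAt p i) v (l ∸ toℕ i)
  after p       zero    = p
  after (e ∷ p) (suc i) = after p i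

  -- Among the `suc l` vertices visited two coincide by the pigeonhole principle, and the closed
  -- part between them is cut out.
  shorten : ∀ {u v l} → n ≤ l → Walk G u v l → ∃[ m ] m < l × Walk G u v m
  shorten {u} {v} {l} n≤l p with Fin.pigeonhole (s≤s n≤l) (vertexAt p)
  ... | i , j , i<j , eq = toℕ i + (l ∸ toℕ j)
                         , <-≤-trans (+-monoˡ-< (l ∸ toℕ j) i<j) (≤-reflexive (m+[n∸m]≡n (s≤s⁻¹ (Fin.toℕ<n j))))
                         , before p i ++ʷ subst (λ w → Walk G w v (l ∸ toℕ j)) (sym eq) (after p j)

  shortWalk : ∀ {u v} b {l} → l ≤ b → Walk G u v l → ∃[ m ] m < n × Walk G u v m
  shortWalk {u} b {l} l≤b p with l <? n
  shortWalk {u} b {l} l≤b p | yes l<n = l , l<n , p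
  shortWalk {u} zero z≤n p | no l≮n = contradiction (≤-<-trans z≤n (Fin.toℕ<n u)) l≮n
  shortWalk {u} (suc b) l≤b p | no l≮n =
    let m , m<l , q = shorten (≮⇒≥ l≮n) p in shortWalk b (s≤s⁻¹ (<-≤-trans m<l l≤b)) q

  -- dist u v = n when v is unreachable from u.
  dist : Fin n → Fin n → ℕ
  dist u v = least (walk? u v) n

  dist⇒walk : ∀ {u v} → dist u v < n → Walk G u v (dist u v)
  dist⇒walk {u} {v} = least-satisfies (walk? u v) n

  walk⇒dist≤ : ∀ {u v l} → Walk G u v l → dist u v ≤ l
  walk⇒dist≤ {u} {v} = least-≤ (walk? u v) n

  walk⇒dist<n : ∀ {u v l} → Walk G u v l → dist u v < n
  walk⇒dist<n p = let m , m<n , q = shortWalk _ ≤-refl p in ≤-<-trans (walk⇒dist≤ q) m<n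

  ball : Fin n → ℕ → Subset n
  ball c r = subset λ v → dist c v ≤? r

  ball-isBall : ∀ c {r} → r < n → IsBall G c (+ r) (ball c r)
  ball-isBall c {r} r<n v = mk⇔
    (λ v∈ → let d≤r = ∈-subset⁻ (λ v → dist c v ≤? r) v∈ in
      dist c v , (dist⇒walk (≤-<-trans d≤r r<n) , λ l → walk⇒dist≤) , +≤+ d≤r)
    (λ { (d , (p , _) , +≤+ d≤r) → ∈-subset⁺ (λ v → dist c v ≤? r) (≤-trans (walk⇒dist≤ p) d≤r) })

  ⊥-isBall : ∀ c → IsBall G c -[1+ 0 ] ⊥
  ⊥-isBall c v = mk⇔ (λ v∈ → ⊥-elim (∉⊥ v∈)) λ { (_ , _ , ()) }

  -- Finite distances are below `n`, so capping the radius at `pred n` keeps the ball. The capped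
  -- radius ranges over a finite set and stays below `n`, the value of `dist` at unreachable
  -- vertices. The member `v` excludes negative radii.
  isBall-truncate : ∀ {c r S v} → IsBall G c r S → v ∈ S →
                    ∃[ s ] s < n × (∀ x → x ∈ S ⇔ dist c x ≤ s)
  isBall-truncate {c} { -[1+ _ ]} {S} {v} isBall v∈S with to (isBall v) v∈S
  ... | _ , _ , ()
  isBall-truncate {c} {+ r} {S} isBall v∈S =
    r ⊓ pred n , s<n , λ x → mk⇔ (inside⇒ x) (⇒inside x)
    where
      s<n : r ⊓ pred n < n
      s<n = ≤-<-trans (m⊓n≤n r (pred n)) (pred-lemma c)
        where
          pred-lemma : ∀ {m} → Fin m → pred m < m
          pred-lemma {suc m} _ = ≤-refl

      inside⇒ : ∀ x → x ∈ S → dist c x ≤ r ⊓ pred n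
      inside⇒ x x∈S with to (isBall x) x∈S
      ... | d , (p , _) , +≤+ d≤r = ⊓-glb (≤-trans (walk⇒dist≤ p) d≤r) (≤-pred′ (walk⇒dist<n p))
        where
          ≤-pred′ : ∀ {a m} → a < m → a ≤ pred m
          ≤-pred′ (s≤s a≤m) = a≤m

      ⇒inside : ∀ x → dist c x ≤ r ⊓ pred n → x ∈ S
      ⇒inside x d≤s = from (isBall x)
        (dist c x , (dist⇒walk (≤-<-trans d≤s s<n) , λ l → walk⇒dist≤) , +≤+ (≤-trans d≤s (m⊓n≤m r (pred n))))

  Realized : (pos neg : Subset n) (c r : Fin n) → Set
  Realized pos neg c r = (∀ v → v ∈ pos → dist c v ≤ toℕ r) × (∀ v → v ∈ neg → toℕ r < dist c v)

-- Vertex sets whose vertices fall into k classes of twins towards the outside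

module _ {n : ℕ} (G : Graph n) (k : ℕ) where

  record Block : Set₁ where
    field
      Class  : Fin k → Pred (Fin n) 0ℓ
      class? : ∀ i → Decidable (Class i)
      twins  : ∀ {i a b w} → Class i a → Class i b → (∀ j → ¬ Class j w) → Adj G a w → Adj G b w


open Block

module _ {n : ℕ} {G : Graph n} {k : ℕ} where

  infix 4 _∈ᴮ_ _∉ᴮ_ _∈ᴮ?_

  _∈ᴮ_ _∉ᴮ_ : Fin n → Block G k → Set
  a ∈ᴮ B = ∃[ i ] Class B i a
  a ∉ᴮ B = ¬ a ∈ᴮ B

  _∈ᴮ?_ : ∀ a (B : Block G k) → Dec (a ∈ᴮ B)
  a ∈ᴮ? B = any? λ i → class? B i a

  module _ (B : Block G k) (i : Fin k) where

    ToClass : Fin n → ℕ → Set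
    ToClass u l = ∃[ a ] Class B i a × Walk G u a l

    toClass? : ∀ u → Decidable (ToClass u)
    toClass? u l = any? λ a → class? B i a ×-dec walk? G u a l

    FromNeighbour : Fin n → ℕ → Set
    FromNeighbour v l = ∃[ a ] ∃[ b ] Class B i a × b ∉ᴮ B × Adj G a b × Walk G b v l

    fromNeighbour? : ∀ v → Decidable (FromNeighbour v)
    fromNeighbour? v l = any? λ a → any? λ b →
      class? B i a ×-dec ¬? (b ∈ᴮ? B) ×-dec adj? G a b ×-dec walk? G b v l

    -- The two summands of the distance through class `i`; the edge leaving the block is counted in
    -- `outer`. If there is no walk, the values `n` and `suc n` exceed every radius below `n`.
    inner outer : Fin n → ℕ
    inner u = least (toClass? u) n
    outer v = suc (least (fromNeighbour? v) n)

  exit : (B : Block G k) → ∀ {u v l} → u ∈ᴮ B → v ∉ᴮ B → Walk G u v l →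
         ∃[ a ] ∃[ b ] ∃[ l₁ ] ∃[ l₂ ]
           Walk G u a l₁ × a ∈ᴮ B × Adj G a b × b ∉ᴮ B × Walk G b v l₂ × l₁ + suc l₂ ≡ l
  exit B u∈B v∉B [] = contradiction u∈B v∉B
  exit B u∈B v∉B (_∷_ {v = w} e p) with w ∈ᴮ? B
  ... | no w∉B = _ , _ , 0 , _ , [] , u∈B , e , w∉B , p , refl
  ... | yes w∈B with exit B w∈B v∉B p
  ...   | a , b , l₁ , l₂ , p₁ , a∈B , ab , b∉B , p₂ , eq =
          a , b , suc l₁ , l₂ , e ∷ p₁ , a∈B , ab , b∉B , p₂ , cong suc eq

  -- A shortest walk is cut at its first edge out of `B`, whose inner end determines the class `i`.
  -- Conversely, the walks realizing the two summands are glued together.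
  dist-across : (B : Block G k) → ∀ {u v r} → u ∈ᴮ B → v ∉ᴮ B → r < n →
                dist G u v ≤ r ⇔ (∃[ i ] inner B i u + outer B i v ≤ r)
  dist-across B {u} {v} {r} u∈B v∉B r<n = mk⇔ forth back
    where
      forth : dist G u v ≤ r → ∃[ i ] inner B i u + outer B i v ≤ r
      forth d≤r with exit B u∈B v∉B (dist⇒walk G (≤-<-trans d≤r r<n))
      ... | a , b , l₁ , l₂ , p₁ , (i , ai) , ab , b∉B , p₂ , eq =
        i , ≤-trans (+-mono-≤ (least-≤ (toClass? B i u) n (a , ai , p₁))
                              (s≤s (least-≤ (fromNeighbour? B i v) n (a , b , ai , b∉B , ab , p₂))))
                    (≤-trans (≤-reflexive eq) d≤r)

      back : ∃[ i ] inner B i u + outer B i v ≤ r → dist G u v ≤ r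
      back (i , le)
        with least-satisfies (toClass? B i u) n (≤-<-trans (≤-trans (m≤m+n _ _) le) r<n)
           | least-satisfies (fromNeighbour? B i v) n (≤-<-trans (≤-trans (≤-trans (n≤1+n _) (m≤n+m _ (inner B i u))) le) r<n)
      ... | a , ai , p | a′ , b , a′i , b∉B , a′b , q =
        -- The inner walk ends in `a`, while the outer one continues an edge at `a′`. Both are in
        -- class `i`, so the edge can be moved from `a′` to its twin `a`.
        ≤-trans (walk⇒dist≤ G (_++ʷ_ G p (twins B a′i ai (λ j bj → b∉B (j , bj)) a′b ∷ q))) le

  dist-across′ : (B : Block G k) → ∀ {u v r} → u ∉ᴮ B → v ∈ᴮ B → r < n →
                 dist G u v ≤ r ⇔ (∃[ i ] outer B i u + inner B i v ≤ r)
  dist-across′ B {u} {v} {r} u∉B v∈B r<n = mk⇔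
    (λ d≤r → let i , le = to across (≤-trans (dist-sym v u (≤-<-trans d≤r r<n)) d≤r)
             in i , subst (_≤ r) (+-comm (inner B i v) _) le)
    (λ (i , le) → let d≤r = from across (i , subst (_≤ r) (+-comm (outer B i u) _) le)
                  in ≤-trans (dist-sym u v (≤-<-trans d≤r r<n)) d≤r)
    where
      across = dist-across B v∈B u∉B r<n

      dist-sym : ∀ a b → dist G b a < n → dist G a b ≤ dist G b a
      dist-sym a b d<n = walk⇒dist≤ G (reverseʷ G (dist⇒walk G d<n))

-- Trees of blocks and the position of a centre

data Tree {n k} {G : Graph n} : Block G k → Set₁ where
  leaf : {B : Block G k} → (∀ {a b} → a ∈ᴮ B → b ∈ᴮ B → a ≡ b) → Tree B
  node : {B L R : Block G k} → Tree L → Tree R →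
         (∀ {a} → a ∈ᴮ L → a ∈ᴮ B) → (∀ {a} → a ∈ᴮ R → a ∈ᴮ B) →
         (∀ {a} → a ∈ᴮ B → a ∈ᴮ L ⊎ a ∈ᴮ R) → (∀ {a} → a ∈ᴮ L → a ∉ᴮ R) → Tree B

module _ {n k : ℕ} {G : Graph n} where

  -- The lowest common ancestor. As a function of two vertices, it can be recomputed by the
  -- reconstructor once these are kept.
  meet : ∀ {B : Block G k} → Tree B → Fin n → Fin n → Block G k
  meet {B} (leaf _) x y = B
  meet {B} (node {L = L} {R} l r _ _ _ _) x y
    with x ∈ᴮ? L ×-dec y ∈ᴮ? L | x ∈ᴮ? R ×-dec y ∈ᴮ? R
  ... | yes _ | _     = meet l x y
  ... | no _  | yes _ = meet r x y
  ... | no _  | no _  = B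

  -- The child of the lowest common ancestor of x and z on the side of x.
  towards : ∀ {B : Block G k} → Tree B → Fin n → Fin n → Block G k
  towards {B} (leaf _) x z = B
  towards (node {L = L} {R} l r _ _ _ _) x z with x ∈ᴮ? L | z ∈ᴮ? L | z ∈ᴮ? R
  ... | yes _ | yes _ | _     = towards l x z
  ... | yes _ | no _  | _     = L
  ... | no _  | _     | yes _ = towards r x z
  ... | no _  | _     | no _  = R

  meet⊆ : ∀ {B : Block G k} (T : Tree B) x y {a} → a ∈ᴮ meet T x y → a ∈ᴮ B
  meet⊆ (leaf _) x y a∈ = a∈
  meet⊆ (node {L = L} {R} l r L⊆ R⊆ _ _) x y a∈
    with x ∈ᴮ? L ×-dec y ∈ᴮ? L | x ∈ᴮ? R ×-dec y ∈ᴮ? R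
  ... | yes _ | _     = L⊆ (meet⊆ l x y a∈)
  ... | no _  | yes _ = R⊆ (meet⊆ r x y a∈)
  ... | no _  | no _  = a∈

  module _ {B L R : Block G k} (l : Tree L) (r : Tree R)
           (L⊆ : ∀ {a} → a ∈ᴮ L → a ∈ᴮ B) (R⊆ : ∀ {a} → a ∈ᴮ R → a ∈ᴮ B)
           (split : ∀ {a} → a ∈ᴮ B → a ∈ᴮ L ⊎ a ∈ᴮ R) (disj : ∀ {a} → a ∈ᴮ L → a ∉ᴮ R) where

    private
      T : Tree B
      T = node l r L⊆ R⊆ split disj

    meet-left : ∀ {x y} → x ∈ᴮ L → y ∈ᴮ L → meet T x y ≡ meet l x y
    meet-left {x} {y} x∈ y∈ with x ∈ᴮ? L ×-dec y ∈ᴮ? L | x ∈ᴮ? R ×-dec y ∈ᴮ? R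
    ... | yes _ | _ = refl
    ... | no ¬p | _ = contradiction (x∈ , y∈) ¬p

    meet-right : ∀ {x y} → x ∈ᴮ R → y ∈ᴮ R → meet T x y ≡ meet r x y
    meet-right {x} {y} x∈ y∈ with x ∈ᴮ? L ×-dec y ∈ᴮ? L | x ∈ᴮ? R ×-dec y ∈ᴮ? R
    ... | yes (x∈L , _) | _ = contradiction x∈ (disj x∈L)
    ... | no _ | yes _ = refl
    ... | no _ | no ¬p = contradiction (x∈ , y∈) ¬p

    meet-across : ∀ {x y} → x ∈ᴮ L → y ∈ᴮ R → meet T x y ≡ B
    meet-across {x} {y} x∈ y∈ with x ∈ᴮ? L ×-dec y ∈ᴮ? L | x ∈ᴮ? R ×-dec y ∈ᴮ? R
    ... | yes (_ , y∈L) | _ = contradiction y∈ (disj y∈L)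
    ... | no _ | yes (x∈R , _) = contradiction x∈R (disj x∈)
    ... | no _ | no _ = refl

    towards-left : ∀ {x z} → x ∈ᴮ L → z ∈ᴮ L → towards T x z ≡ towards l x z
    towards-left {x} {z} x∈ z∈ with x ∈ᴮ? L | z ∈ᴮ? L | z ∈ᴮ? R
    ... | yes _ | yes _ | _ = refl
    ... | yes _ | no z∉ | _ = contradiction z∈ z∉
    ... | no x∉ | _     | _ = contradiction x∈ x∉

    towards-right : ∀ {x z} → x ∈ᴮ R → z ∈ᴮ R → towards T x z ≡ towards r x z
    towards-right {x} {z} x∈ z∈ with x ∈ᴮ? L | z ∈ᴮ? L | z ∈ᴮ? R
    ... | yes x∈L | _ | _     = contradiction x∈ (disj x∈L)
    ... | no _    | _ | yes _ = refl
    ... | no _    | _ | no z∉ = contradiction z∈ z∉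

    towards-left-right : ∀ {x z} → x ∈ᴮ L → z ∈ᴮ R → towards T x z ≡ L
    towards-left-right {x} {z} x∈ z∈ with x ∈ᴮ? L | z ∈ᴮ? L | z ∈ᴮ? R
    ... | yes _ | yes z∈L | _ = contradiction z∈ (disj z∈L)
    ... | yes _ | no _    | _ = refl
    ... | no x∉ | _       | _ = contradiction x∈ x∉

    towards-right-left : ∀ {x z} → x ∈ᴮ R → z ∈ᴮ L → towards T x z ≡ R
    towards-right-left {x} {z} x∈ z∈ with x ∈ᴮ? L | z ∈ᴮ? L | z ∈ᴮ? R
    ... | yes x∈L | _ | _       = contradiction x∈ (disj x∈L)
    ... | no _    | _ | yes z∈R = contradiction z∈R (disj z∈)
    ... | no _    | _ | no _    = refl

  module _ {X : Pred (Fin n) 0ℓ} (X? : Decidable X) where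

    data Span {B : Block G k} (T : Tree B) : Set where
      absent  : (∀ {v} → v ∈ᴮ B → ¬ X v) → Span T
      spanned : ∀ {x y} → X x → X y → x ∈ᴮ B → y ∈ᴮ B → (∀ {v} → v ∈ᴮ B → X v → v ∈ᴮ meet T x y) → Span T

    -- If both children contain vertices of `X`, one from each has the whole of `B` as lowest common
    -- ancestor. If only one child does, its pair still serves.
    span : ∀ {B : Block G k} (T : Tree B) → Span T
    span {B} (leaf unique) with any? (λ x → X? x ×-dec x ∈ᴮ? B)
    ... | yes (x , Xx , x∈) = spanned Xx Xx x∈ x∈ λ v∈ _ → v∈
    ... | no ¬x             = absent λ v∈ Xv → ¬x (_ , Xv , v∈)
    span (node l r L⊆ R⊆ split disj) with span l | span r
    ... | absent ¬l | absent ¬r = absent λ v∈ → [ ¬l , ¬r ] (split v∈)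
    ... | spanned Xx Xy x∈ y∈ all | absent ¬r =
      spanned Xx Xy (L⊆ x∈) (L⊆ y∈) λ v∈ Xv →
        subst (_ ∈ᴮ_) (sym (meet-left l r L⊆ R⊆ split disj x∈ y∈))
          ([ (λ v∈L → all v∈L Xv) , (λ v∈R → contradiction Xv (¬r v∈R)) ] (split v∈))
    ... | absent ¬l | spanned Xx Xy x∈ y∈ all =
      spanned Xx Xy (R⊆ x∈) (R⊆ y∈) λ v∈ Xv →
        subst (_ ∈ᴮ_) (sym (meet-right l r L⊆ R⊆ split disj x∈ y∈))
          ([ (λ v∈L → contradiction Xv (¬l v∈L)) , (λ v∈R → all v∈R Xv) ] (split v∈))
    ... | spanned Xx _ x∈ _ _ | spanned Xy _ y∈ _ _ =
      spanned Xx Xy (L⊆ x∈) (R⊆ y∈) λ v∈ _ →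
        subst (_ ∈ᴮ_) (sym (meet-across l r L⊆ R⊆ split disj x∈ y∈)) v∈

    module _ (c : Fin n) where

      -- The invariant of the climb. The separating node Q is `meet T x y`; the node P is `B` itself
      -- in `beside` and `towards T x z` in `between`.
      data Position {B : Block G k} (T : Tree B) : Set where
        absent  : (∀ {v} → v ∈ᴮ B → ¬ X v) → Position T
        self    : X c → Position T
        beside  : ∀ {x y} → X x → X y → x ∈ᴮ B → y ∈ᴮ B →
                  (∀ {v} → v ∈ᴮ B → X v → v ∈ᴮ meet T x y) → c ∉ᴮ meet T x y → Position T
        between : ∀ {x y z} → X x → X y → X z → x ∈ᴮ B → y ∈ᴮ B → z ∈ᴮ B → c ∈ᴮ towards T x z →
                  (∀ {v} → v ∈ᴮ towards T x z → X v → v ∈ᴮ meet T x y) → c ∉ᴮ meet T x y → Position T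

      -- One step up from the child `C` containing `c`, with sibling `D`. The rules for `meet` and
      -- `towards` are parameters, so that steps from the left and from the right share one proof.
      ascend : ∀ {B C D : Block G k} {T : Tree B} {T₁ : Tree C} {T₂ : Tree D} →
               (∀ {a} → a ∈ᴮ C → a ∈ᴮ B) → (∀ {a} → a ∈ᴮ D → a ∈ᴮ B) → (∀ {a} → a ∈ᴮ B → a ∈ᴮ C ⊎ a ∈ᴮ D) →
               (∀ {x y} → x ∈ᴮ C → y ∈ᴮ C → meet T x y ≡ meet T₁ x y) →
               (∀ {x y} → x ∈ᴮ D → y ∈ᴮ D → meet T x y ≡ meet T₂ x y) →
               (∀ {x z} → x ∈ᴮ C → z ∈ᴮ C → towards T x z ≡ towards T₁ x z) →
               (∀ {x z} → x ∈ᴮ C → z ∈ᴮ D → towards T x z ≡ C) →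
               c ∈ᴮ C → c ∉ᴮ D → Position T₁ → Span T₂ → Position T
      ascend C⊆ D⊆ split meetC meetD towC towCD c∈C c∉D (absent ¬C) (absent ¬D) =
        absent λ v∈ → [ ¬C , ¬D ] (split v∈)
      -- The first vertices of `X` appear in the sibling. Their meet lies inside `D` and thus misses
      -- `c`.
      ascend {T₂ = T₂} C⊆ D⊆ split meetC meetD towC towCD c∈C c∉D (absent ¬C) (spanned Xx Xy x∈ y∈ all) =
        beside Xx Xy (D⊆ x∈) (D⊆ y∈)
          (λ v∈ Xv → subst (_ ∈ᴮ_) (sym (meetD x∈ y∈))
                       ([ (λ v∈C → contradiction Xv (¬C v∈C)) , (λ v∈D → all v∈D Xv) ] (split v∈)))
          (λ c∈ → c∉D (meet⊆ T₂ _ _ (subst (c ∈ᴮ_) (meetD x∈ y∈) c∈)))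
      ascend C⊆ D⊆ split meetC meetD towC towCD c∈C c∉D (self Xc) _ = self Xc
      ascend C⊆ D⊆ split meetC meetD towC towCD c∈C c∉D (beside Xx Xy x∈ y∈ all c∉) (absent ¬D) =
        beside Xx Xy (C⊆ x∈) (C⊆ y∈)
          (λ v∈ Xv → subst (_ ∈ᴮ_) (sym (meetC x∈ y∈))
                       ([ (λ v∈C → all v∈C Xv) , (λ v∈D → contradiction Xv (¬D v∈D)) ] (split v∈)))
          (λ c∈ → c∉ (subst (c ∈ᴮ_) (meetC x∈ y∈) c∈))
      -- The sibling may hold vertices of `X` outside Q, so P must not grow to `B`. A vertex `z` of
      -- the sibling identifies `C` as P from now on.
      ascend C⊆ D⊆ split meetC meetD towC towCD c∈C c∉D (beside Xx Xy x∈ y∈ all c∉) (spanned Xz _ z∈ _ _) =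
        between Xx Xy Xz (C⊆ x∈) (C⊆ y∈) (D⊆ z∈)
          (subst (c ∈ᴮ_) (sym (towCD x∈ z∈)) c∈C)
          (λ v∈ Xv → subst (_ ∈ᴮ_) (sym (meetC x∈ y∈)) (all (subst (_ ∈ᴮ_) (towCD x∈ z∈) v∈) Xv))
          (λ c∈ → c∉ (subst (c ∈ᴮ_) (meetC x∈ y∈) c∈))
      ascend C⊆ D⊆ split meetC meetD towC towCD c∈C c∉D (between Xx Xy Xz x∈ y∈ z∈ c∈ all c∉) _ =
        between Xx Xy Xz (C⊆ x∈) (C⊆ y∈) (C⊆ z∈)
          (subst (c ∈ᴮ_) (sym (towC x∈ z∈)) c∈)
          (λ v∈ Xv → subst (_ ∈ᴮ_) (sym (meetC x∈ y∈)) (all (subst (_ ∈ᴮ_) (towC x∈ z∈) v∈) Xv))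
          (λ c∈ → c∉ (subst (c ∈ᴮ_) (meetC x∈ y∈) c∈))

      locate : ∀ {B : Block G k} (T : Tree B) → c ∈ᴮ B → Position T
      locate (leaf unique) c∈ with X? c
      ... | yes Xc = self Xc
      ... | no ¬Xc = absent λ v∈ Xv → ¬Xc (subst X (unique v∈ c∈) Xv)
      locate {B} (node l r L⊆ R⊆ split disj) c∈ with split c∈
      ... | inj₁ c∈L = ascend L⊆ R⊆ split
        (meet-left {B} l r L⊆ R⊆ split disj) (meet-right {B} l r L⊆ R⊆ split disj)
        (towards-left {B} l r L⊆ R⊆ split disj) (towards-left-right {B} l r L⊆ R⊆ split disj)
        c∈L (disj c∈L) (locate l c∈L) (span r)
      ... | inj₂ c∈R = ascend R⊆ L⊆ (λ v∈ → swap (split v∈))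
        (meet-right {B} l r L⊆ R⊆ split disj) (meet-left {B} l r L⊆ R⊆ split disj)
        (towards-right {B} l r L⊆ R⊆ split disj) (towards-right-left {B} l r L⊆ R⊆ split disj)
        c∈R (λ c∈L → disj c∈L c∈R) (locate r c∈R) (span l)

-- Cliquewidth expressions

module _ {n k : ℕ} (G : Graph n) where

  -- Edges are preserved but not reflected, because joins further up may still add edges.
  Embeds : ∀ {m} → LabelledGraph k m → (Fin m → Fin n) → Set
  Embeds H f = (∀ u v → f u ≡ f v → u ≡ v)
             × (∀ u v → Adj (graph H) u v → Adj G (f u) (f v))

  -- Edges of G added after the construction of H only depend on the labels in H.
  Oblivious : ∀ {m} → LabelledGraph k m → (Fin m → Fin n) → Set
  Oblivious H f = ∀ {u v} w → label H u ≡ label H v → Adj G (f u) w →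
                  (∃[ w′ ] f w′ ≡ w × Adj (graph H) u w′) ⊎ Adj G (f v) w

  image : ∀ {m} (H : LabelledGraph k m) (f : Fin m → Fin n) → Oblivious H f → Block G k
  image H f obl = record
    { Class  = λ i a → ∃[ u ] f u ≡ a × label H u ≡ i
    ; class? = λ i a → any? λ u → f u Fin.≟ a ×-dec label H u Fin.≟ i
    ; twins  = twins′
    }
    where
      twins′ : ∀ {i a b w} → ∃[ u ] f u ≡ a × label H u ≡ i → ∃[ v ] f v ≡ b × label H v ≡ i →
               (∀ j → ¬ (∃[ x ] f x ≡ w × label H x ≡ j)) → Adj G a w → Adj G b w
      twins′ {w = w} (u , refl , ui) (v , refl , vi) w∉ uw with obl w (trans ui (sym vi)) uw
      ... | inj₁ (w′ , eq , _) = ⊥-elim (w∉ _ (w′ , eq , refl))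
      ... | inj₂ vw            = vw

  record Decomposition {m} (f : Fin m → Fin n) : Set₁ where
    field
      block : Block G k
      tree  : Tree block
      ∈⁺    : ∀ u → f u ∈ᴮ block
      ∈⁻    : ∀ {a} → a ∈ᴮ block → ∃[ u ] f u ≡ a

  open Decomposition

  -- Both hypotheses are handed down from an expression to its subexpressions. Only disjoint unions
  -- create inner nodes; joins and relabellings keep the vertex set and pass on the tree.
  decompose : ∀ {m} (e : Expr k m) (f : Fin m → Fin n) → Embeds ⟦ e ⟧ f → Oblivious ⟦ e ⟧ f → Decomposition f
  decompose e@(single i) f emb obl = record
    { block = image ⟦ e ⟧ f obl
    ; tree  = leaf λ { (_ , zero , refl , _) (_ , zero , refl , _) → refl }
    ; ∈⁺    = λ u → i , u , refl , refl
    ; ∈⁻    = λ (_ , u , eq , _) → u , eq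
    }
  decompose e@(disjointUnion {m₁} {m₂} e₁ e₂) f (inj , hom) obl = record
    { block = image ⟦ e ⟧ f obl
    ; tree  = node (tree d₁) (tree d₂)
        (λ a∈ → let u , eq = ∈⁻ d₁ a∈ in _ , u ↑ˡ m₂ , eq , refl)
        (λ a∈ → let u , eq = ∈⁻ d₂ a∈ in _ , m₁ ↑ʳ u , eq , refl)
        splits disjoint
    ; ∈⁺    = λ u → _ , u , refl , refl
    ; ∈⁻    = λ (_ , u , eq , _) → u , eq
    }
    where
      obl₁ : Oblivious ⟦ e₁ ⟧ (λ u → f (u ↑ˡ m₂))
      obl₁ {u} {v} w same uw with obl {u ↑ˡ m₂} {v ↑ˡ m₂} w same′ uw
        where
          same′ : label ⟦ e ⟧ (u ↑ˡ m₂) ≡ label ⟦ e ⟧ (v ↑ˡ m₂)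
          same′ rewrite Fin.splitAt-↑ˡ m₁ u m₂ | Fin.splitAt-↑ˡ m₁ v m₂ = same
      ... | inj₂ vw = inj₂ vw
      ... | inj₁ (w′ , eq , uw′) rewrite Fin.splitAt-↑ˡ m₁ u m₂ with splitAt m₁ w′ in eq′ | uw′
      -- No edge of a disjoint union crosses between its parts, so `w′` lies on the left as well.
      ...   | inj₁ w₁ | ⊎.inj₁ uw₁ = inj₁ (w₁ , trans (cong f (Fin.splitAt⁻¹-↑ˡ eq′)) eq , uw₁)

      obl₂ : Oblivious ⟦ e₂ ⟧ (λ u → f (m₁ ↑ʳ u))
      obl₂ {u} {v} w same uw with obl {m₁ ↑ʳ u} {m₁ ↑ʳ v} w same′ uw
        where
          same′ : label ⟦ e ⟧ (m₁ ↑ʳ u) ≡ label ⟦ e ⟧ (m₁ ↑ʳ v)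
          same′ rewrite Fin.splitAt-↑ʳ m₁ m₂ u | Fin.splitAt-↑ʳ m₁ m₂ v = same
      ... | inj₂ vw = inj₂ vw
      ... | inj₁ (w′ , eq , uw′) rewrite Fin.splitAt-↑ʳ m₁ m₂ u with splitAt m₁ w′ in eq′ | uw′
      ...   | inj₂ w₂ | ⊎.inj₂ uw₂ = inj₁ (w₂ , trans (cong f (Fin.splitAt⁻¹-↑ʳ eq′)) eq , uw₂)

      hom₁ : ∀ u v → Adj (graph ⟦ e₁ ⟧) u v → Adj G (f (u ↑ˡ m₂)) (f (v ↑ˡ m₂))
      hom₁ u v uv = hom _ _ uv′
        where
          uv′ : Adj (graph ⟦ e ⟧) (u ↑ˡ m₂) (v ↑ˡ m₂)
          uv′ rewrite Fin.splitAt-↑ˡ m₁ u m₂ | Fin.splitAt-↑ˡ m₁ v m₂ = ⊎.inj₁ uv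

      hom₂ : ∀ u v → Adj (graph ⟦ e₂ ⟧) u v → Adj G (f (m₁ ↑ʳ u)) (f (m₁ ↑ʳ v))
      hom₂ u v uv = hom _ _ uv′
        where
          uv′ : Adj (graph ⟦ e ⟧) (m₁ ↑ʳ u) (m₁ ↑ʳ v)
          uv′ rewrite Fin.splitAt-↑ʳ m₁ m₂ u | Fin.splitAt-↑ʳ m₁ m₂ v = ⊎.inj₂ uv

      d₁ : Decomposition (λ u → f (u ↑ˡ m₂))
      d₁ = decompose e₁ _ ((λ u v eq → Fin.↑ˡ-injective m₂ u v (inj _ _ eq)) , hom₁) obl₁

      d₂ : Decomposition (λ u → f (m₁ ↑ʳ u))
      d₂ = decompose e₂ _ ((λ u v eq → Fin.↑ʳ-injective m₁ u v (inj _ _ eq)) , hom₂) obl₂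

      splits : ∀ {a} → a ∈ᴮ image ⟦ e ⟧ f obl → a ∈ᴮ block d₁ ⊎ a ∈ᴮ block d₂
      splits (_ , u , refl , _) with splitAt m₁ u in eq
      ... | inj₁ u₁ = inj₁ (subst (λ x → f x ∈ᴮ block d₁) (Fin.splitAt⁻¹-↑ˡ eq) (∈⁺ d₁ u₁))
      ... | inj₂ u₂ = inj₂ (subst (λ x → f x ∈ᴮ block d₂) (Fin.splitAt⁻¹-↑ʳ eq) (∈⁺ d₂ u₂))

      disjoint : ∀ {a} → a ∈ᴮ block d₁ → a ∉ᴮ block d₂
      disjoint a∈₁ a∈₂ with ∈⁻ d₁ a∈₁ | ∈⁻ d₂ a∈₂
      ... | u₁ , eq₁ | u₂ , eq₂
        with () ← trans (sym (Fin.splitAt-↑ˡ m₁ u₁ m₂))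
                    (trans (cong (splitAt m₁) (inj _ _ (trans eq₁ (sym eq₂)))) (Fin.splitAt-↑ʳ m₁ m₂ u₂))
  decompose (join i j i≢j e) f (inj , hom) obl =
    decompose e f (inj , λ u v uv → hom u v (inj₁ uv)) obl′
    where
      obl′ : Oblivious ⟦ e ⟧ f
      obl′ {u} {v} w same uw with obl {u} {v} w same uw
      ... | inj₂ vw = inj₂ vw
      ... | inj₁ (w′ , eq , inj₁ uw′) = inj₁ (w′ , eq , uw′)
      -- The edge comes from this very join, which also joins `v` to `w′` because `v` has the label
      -- of `u`.
      ... | inj₁ (w′ , refl , inj₂ (inj₁ (ui , w′j))) = inj₂ (hom v w′ (inj₂ (inj₁ (trans (sym same) ui , w′j))))
      ... | inj₁ (w′ , refl , inj₂ (inj₂ (uj , w′i))) = inj₂ (hom v w′ (inj₂ (inj₂ (trans (sym same) uj , w′i))))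
  decompose (relabel i j e) f emb obl = decompose e f emb λ {u} {v} w same →
    obl w (cong (λ l → if does (l Fin.≟ i) then j else l) same)

  -- At the root every edge of `G` is already an edge of the expression's graph, so the first
  -- alternative of `Oblivious` always holds.
  iso⇒decomposition : ∀ {m} (e : Expr k m) (iso : graph ⟦ e ⟧ ≅ G) →
                      Decomposition (Inverse.to (_≅_.vertices iso))
  iso⇒decomposition e iso = decompose e f
    ((λ u v eq → trans (sym (Inverse.strictlyInverseʳ vs u)) (trans (cong (Inverse.from vs) eq) (Inverse.strictlyInverseʳ vs v)))
    , λ u v → to (_≅_.edges iso u v))
    (λ {u} w _ uw → inj₁ (Inverse.from vs w , Inverse.strictlyInverseˡ vs w ,
       from (_≅_.edges iso _ _) (subst (Adj G (f u)) (sym (Inverse.strictlyInverseˡ vs w)) uw)))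
    where
      vs = _≅_.vertices iso
      f = Inverse.to vs

-- Regions of candidate centres

module _ {n : ℕ} (G : Graph n) (K : ℕ) where

  -- A common form for all positions of the centre: on the cell, the distance to a sample vertex is
  -- replaced by a minimum over `K` coordinates of a part depending on the centre plus a part
  -- depending on the vertex.
  record Region : Set₁ where
    field
      Cell     : Pred (Fin n) 0ℓ
      cell?    : Decidable Cell
      near far : Fin K → Fin n → ℕ

    Resolves : Pred (Fin n) 0ℓ → Set
    Resolves X = ∀ {c r x} → Cell c → r < n → X x → dist G c x ≤ r ⇔ (∃[ j ] near j c + far j x ≤ r)

  vertexRegion : Fin n → Region
  vertexRegion v = record
    { Cell = _≡ v ; cell? = Fin._≟ v ; near = λ _ _ → 0 ; far = λ _ → dist G v }

  -- All coordinates agree, so any index attains the minimum; the argument of type `Fin K` supplies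
  -- one.
  vertexRegion-resolves : ∀ v → Fin K → ∀ {X} → Region.Resolves (vertexRegion v) X
  vertexRegion-resolves v j refl _ _ = mk⇔ (j ,_) proj₂

module _ {n k : ℕ} {G : Graph n} where

  -- Radii are below n, so the rank n shuts off the classes of a block that does
  -- not separate x from the cell.
  blockRegion : Block G k → Block G k → Region G (k + k)
  blockRegion P Q = record
    { Cell  = λ c → c ∈ᴮ P × c ∉ᴮ Q
    ; cell? = λ c → c ∈ᴮ? P ×-dec ¬? (c ∈ᴮ? Q)
    ; near  = λ j c → [ (λ i → outer Q i c) , (λ i → inner P i c) ] (splitAt k j)
    ; far   = λ j x → [ (λ i → if does (x ∈ᴮ? Q) then inner Q i x else n)
                      , (λ i → if does (x ∈ᴮ? P) then n else outer P i x) ] (splitAt k j)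
    }

  -- A vertex of `X` in `Q` is separated from the cell by `Q`; any other lies outside `P` and is
  -- separated by `P`. The first `k` coordinates handle crossing `Q`, the last `k` crossing `P`.
  blockRegion-resolves : ∀ {P Q} {X : Pred (Fin n) 0ℓ} → (∀ {v} → v ∈ᴮ P → X v → v ∈ᴮ Q) →
                         Region.Resolves (blockRegion P Q) X
  blockRegion-resolves {P} {Q} {X} P∩X⊆Q {c} {r} {x} (c∈P , c∉Q) r<n Xx = mk⇔ (crossing (x ∈ᴮ? Q)) (λ (j , le) → back j le)
    where
      open Region (blockRegion P Q)

      too-far : ∀ m → ¬ m + n ≤ r
      too-far m le = <⇒≱ r<n (≤-trans (m≤n+m n m) le)

      left : x ∈ᴮ Q → ∀ i → outer Q i c + inner Q i x ≤ r → near (i ↑ˡ k) c + far (i ↑ˡ k) x ≤ r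
      left x∈Q i le rewrite Fin.splitAt-↑ˡ k i k | dec-true (x ∈ᴮ? Q) x∈Q = le

      right : x ∉ᴮ P → ∀ i → inner P i c + outer P i x ≤ r → near (k ↑ʳ i) c + far (k ↑ʳ i) x ≤ r
      right x∉P i le rewrite Fin.splitAt-↑ʳ k k i | dec-false (x ∈ᴮ? P) x∉P = le

      crossing : Dec (x ∈ᴮ Q) → dist G c x ≤ r → ∃[ j ] near j c + far j x ≤ r
      crossing (yes x∈Q) d≤r = let i , le = to (dist-across′ Q c∉Q x∈Q r<n) d≤r in i ↑ˡ k , left x∈Q i le
      crossing (no x∉Q)  d≤r =
        let x∉P = λ x∈P → x∉Q (P∩X⊆Q x∈P Xx)
            i , le = to (dist-across P c∈P x∉P r<n) d≤r
        in k ↑ʳ i , right x∉P i le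

      back : ∀ j → near j c + far j x ≤ r → dist G c x ≤ r
      back j le with splitAt k j
      back j le | inj₁ i with x ∈ᴮ? Q
      ... | yes x∈Q = from (dist-across′ Q c∉Q x∈Q r<n) (i , le)
      ... | no _    = contradiction le (too-far (outer Q i c))
      back j le | inj₂ i with x ∈ᴮ? P
      ... | yes _   = contradiction le (too-far (inner P i c))
      ... | no x∉P  = from (dist-across P c∈P x∉P r<n) (i , le)

-- The compression scheme

-- Three anchors `x`, `y`, `z` fix the region. Each of its `k + k` coordinates then has one positive
-- and one negative slot.
roles : ℕ → ℕ
roles k = 3 + ((k + k) + (k + k))

module _ {n k : ℕ} {G : Graph n} {B : Block G k} (T : Tree B) where

  slot⁺ slot⁻ : Fin (k + k) → Fin (roles k)
  slot⁺ j = 3 ↑ʳ (j ↑ˡ (k + k))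
  slot⁻ j = 3 ↑ʳ ((k + k) ↑ʳ j)

  assign : (x y z : Maybe (Fin n)) (hi lo : Fin (k + k) → Maybe (Fin n)) → Fin (roles k) → Maybe (Fin n)
  assign x y z hi lo zero                = x
  assign x y z hi lo (suc zero)          = y
  assign x y z hi lo (suc (suc zero))    = z
  assign x y z hi lo (suc (suc (suc q))) = [ hi , lo ] (splitAt (k + k) q)

  -- The number of anchors tells the cases apart: none for a sample without positive vertices, one
  -- for `self`, two for `beside`, three for `between`.
  regionOf : (x y z : Maybe (Fin n)) → Maybe (Region G (k + k))
  regionOf nothing  _        _        = nothing
  regionOf (just x) nothing  _        = just (vertexRegion G (k + k) x)
  regionOf (just x) (just y) nothing  = just (blockRegion B (meet T x y))
  regionOf (just x) (just y) (just z) = just (blockRegion (towards T x z) (meet T x y))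

  module _ (R : Region G (k + k)) (h : Fin (roles k) → Maybe (Fin n)) where
    open Region R

    Accepts : Fin n → Fin n → Set
    Accepts c r = Cell c × (∀ j → All (λ y → near j c + far j y ≤ toℕ r) (h (slot⁺ j))
                                × All (λ z → toℕ r < near j c + far j z) (h (slot⁻ j)))

    accepts? : ∀ c r → Dec (Accepts c r)
    accepts? c r = cell? c ×-dec all? λ j →
      All.dec (λ y → near j c + far j y ≤? toℕ r) (h (slot⁺ j)) ×-dec
      All.dec (λ z → toℕ r <? near j c + far j z) (h (slot⁻ j))

    search : Dec (∃[ c ] ∃[ r ] Accepts c r)
    search = any? λ c → any? λ r → accepts? c r

    -- Only the positive vertices that the original ball reaches through `j` compete for `slot⁺ j`.
    -- All negative ones compete for `slot⁻ j`, with the order reversed so that the nearest wins.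
    Extremes : (pos neg : Subset n) (c r : Fin n) → Set
    Extremes pos neg c r = ∀ j →
      Greatest (λ x → x ∈ pos × near j c + far j x ≤ toℕ r) (λ x y → far j x ≤ far j y) (h (slot⁺ j)) ×
      Greatest (_∈ neg) (λ x y → far j y ≤ far j x) (h (slot⁻ j))

  found : ∀ R h → Dec (∃[ c ] ∃[ r ] Accepts R h c r) → Subset n
  found R h (yes (c , r , _)) = ball G c (toℕ r)
  found R h (no _)            = ⊥

  reconstructIn : Maybe (Region G (k + k)) → (Fin (roles k) → Maybe (Fin n)) → Subset n
  reconstructIn nothing  h = ⊥
  reconstructIn (just R) h = found R h (search R h)

  reconstruct : (Fin (roles k) → Maybe (Fin n)) → Subset n
  reconstruct h = reconstructIn (regionOf (h 0F) (h 1F) (h 2F)) h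

  -- Undecodable input yields the empty set, which is a ball of negative radius around any vertex.
  reconstruct-isBall : Fin n → ∀ h → ∃[ c ] ∃[ r ] IsBall G c r (reconstruct h)
  reconstruct-isBall c₀ h with regionOf (h 0F) (h 1F) (h 2F)
  ... | nothing = c₀ , -[1+ 0 ] , ⊥-isBall G c₀
  ... | just R with search R h
  ...   | yes (c , r , _) = c , + toℕ r , ball-isBall G c (Fin.toℕ<n r)
  ...   | no _            = c₀ , -[1+ 0 ] , ⊥-isBall G c₀

  module _ {pos neg : Subset n} {c r : Fin n} (realized : Realized G pos neg c r)
           {R : Region G (k + k)} (resolves : Region.Resolves R (_∈ pos ∪ neg)) (c∈R : Region.Cell R c)
           (h : Fin (roles k) → Maybe (Fin n)) (extremes : Extremes R h pos neg c r) where
    open Region R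

    -- The original centre and radius pass the test, so the search cannot fail: a negative vertex
    -- within reach through some coordinate would lie in the ball.
    extremes⇒accepts : Accepts R h c r
    extremes⇒accepts = c∈R , λ j → let hi , lo = extremes j in below j hi , above j lo
      where
        below : ∀ j {m} → Greatest (λ x → x ∈ pos × near j c + far j x ≤ toℕ r) _ m →
                All (λ y → near j c + far j y ≤ toℕ r) m
        below j {nothing} _              = nothing
        below j {just y}  ((_ , le) , _) = just le

        above : ∀ j {m} → Greatest (_∈ neg) _ m → All (λ z → toℕ r < near j c + far j z) m
        above j {nothing} _          = nothing
        above j {just z}  (z∈ , _) = just (≰⇒> λ le → <⇒≱ (proj₂ realized z z∈)
          (from (resolves c∈R (Fin.toℕ<n r) (x∈p∪q⁺ {p = pos} (inj₂ z∈))) (j , le)))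

    -- The original ball reaches a positive `v` through some `j`. The vertex kept for `j` is at
    -- least as far, and the new ball reaches it through `j`, hence also `v`. If the new ball
    -- reached a negative vertex through `j`, it would reach the nearest one too, which the test
    -- forbids.
    accepted-realizes : ∀ {c′ r′} → Accepts R h c′ r′ → Realized G pos neg c′ r′
    accepted-realizes {c′} {r′} (c′∈R , accepts) = covers , avoids
      where
        covers : ∀ v → v ∈ pos → dist G c′ v ≤ toℕ r′
        covers v v∈ with to (resolves c∈R (Fin.toℕ<n r) (x∈p∪q⁺ (inj₁ v∈))) (proj₁ realized v v∈)
        ... | j , le with h (slot⁺ j) | proj₁ (extremes j) | proj₁ (accepts j)
        ...   | nothing | none     | _       = contradiction (v∈ , le) (none v)
        ...   | just y  | (_ , ub) | just y≤ =
          from (resolves c′∈R (Fin.toℕ<n r′) (x∈p∪q⁺ (inj₁ v∈)))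
            (j , ≤-trans (+-monoʳ-≤ (near j c′) (ub v (v∈ , le))) y≤)

        avoids : ∀ v → v ∈ neg → toℕ r′ < dist G c′ v
        avoids v v∈ = ≰⇒> λ d≤r′ →
          let j , le = to (resolves c′∈R (Fin.toℕ<n r′) (x∈p∪q⁺ {p = pos} (inj₂ v∈))) d≤r′ in refute j le
          where
            refute : ∀ j → ¬ near j c′ + far j v ≤ toℕ r′
            refute j le with h (slot⁻ j) | proj₂ (extremes j) | proj₂ (accepts j)
            ... | nothing | none     | _       = none v v∈
            ... | just z  | (_ , lb) | just z> = <⇒≱ z> (≤-trans (+-monoʳ-≤ (near j c′) (lb v v∈)) le)

    found-realizes : pos ⊆ found R h (search R h) × found R h (search R h) ∩ neg ≡ ⊥
    found-realizes with search R h
    ... | no none = contradiction (c , r , extremes⇒accepts) none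
    ... | yes (c′ , r′ , accepted) with accepted-realizes accepted
    ...   | covers , avoids =
      (λ v∈ → ∈-subset⁺ (λ v → dist G c′ v ≤? toℕ r′) (covers _ v∈)) ,
      ∩≡⊥⁺ λ v∈ball v∈neg → <⇒≱ (avoids _ v∈neg) (∈-subset⁻ (λ v → dist G c′ v ≤? toℕ r′) v∈ball)

  extremes-exist : ∀ (R : Region G (k + k)) (pos neg : Subset n) (c r : Fin n) →
    let open Region R in ∀ j →
      ∃ (Greatest (λ x → x ∈ pos × near j c + far j x ≤ toℕ r) (λ x y → far j x ≤ far j y)) ×
      ∃ (Greatest (_∈ neg) (λ x y → far j y ≤ far j x))
  extremes-exist R pos neg c r j =
    greatest (λ x → x ∈? pos ×-dec near j c + far j x ≤? toℕ r) (λ x y → far j x ≤ far j y)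
      ≤-refl (λ x y → ≤-total (far j x) (far j y)) ≤-trans ,
    greatest (_∈? neg) (λ x y → far j y ≤ far j x)
      ≤-refl (λ x y → ≤-total (far j y) (far j x)) (λ y≤x z≤y → ≤-trans z≤y y≤x)
    where open Region R

  -- Quantifies over all `h` that agree with `g` pointwise, since decoding recovers the roles only
  -- pointwise.
  Determines : (pos neg : Subset n) → (Fin (roles k) → Maybe (Fin n)) → Set
  Determines pos neg g = ∀ h → (∀ q → h q ≡ g q) → pos ⊆ reconstruct h × reconstruct h ∩ neg ≡ ⊥

  module _ {pos neg : Subset n} {c r : Fin n} (realized : Realized G pos neg c r) where

    X : Subset n
    X = pos ∪ neg

    anchored : ∀ x y z {R} → regionOf x y z ≡ just R → Region.Resolves R (_∈ X) → Region.Cell R c →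
               All (_∈ X) x → All (_∈ X) y → All (_∈ X) z →
               ∃[ g ] Within X g × Determines pos neg g
    anchored x y z {R} eq resolves c∈R x∈ y∈ z∈ = g , g∈X , determines
      where
        ext = extremes-exist R pos neg c r

        hi lo : Fin (k + k) → Maybe (Fin n)
        hi j = proj₁ (proj₁ (ext j))
        lo j = proj₁ (proj₂ (ext j))

        g : Fin (roles k) → Maybe (Fin n)
        g = assign x y z hi lo

        member : ∀ {m v} → All (_∈ X) m → m ≡ just v → v ∈ X
        member (just v∈) refl = v∈

        hi∈ : ∀ {P : Pred (Fin n) 0ℓ} {_≲_ m v} → Greatest (λ x → x ∈ pos × P x) _≲_ m → m ≡ just v → v ∈ X
        hi∈ ((v∈ , _) , _) refl = x∈p∪q⁺ (inj₁ v∈)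

        lo∈ : ∀ {_≲_ m v} → Greatest (_∈ neg) _≲_ m → m ≡ just v → v ∈ X
        lo∈ (v∈ , _) refl = x∈p∪q⁺ {p = pos} (inj₂ v∈)

        g∈X : Within X g
        g∈X zero                eq = member x∈ eq
        g∈X (suc zero)          eq = member y∈ eq
        g∈X (suc (suc zero))    eq = member z∈ eq
        g∈X (suc (suc (suc q))) eq with splitAt (k + k) q
        ... | inj₁ j = hi∈ (proj₂ (proj₁ (ext j))) eq
        ... | inj₂ j = lo∈ (proj₂ (proj₂ (ext j))) eq

        determines : Determines pos neg g
        determines h h≗g = subst (λ R → pos ⊆ reconstructIn R h × reconstructIn R h ∩ neg ≡ ⊥) (sym eq′)
          (found-realizes realized resolves c∈R h λ j →
            subst (Greatest _ _) (sym (trans (h≗g (slot⁺ j)) (cong [ hi , lo ] (Fin.splitAt-↑ˡ (k + k) j (k + k)))))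
                  (proj₂ (proj₁ (ext j))) ,
            subst (Greatest _ _) (sym (trans (h≗g (slot⁻ j)) (cong [ hi , lo ] (Fin.splitAt-↑ʳ (k + k) (k + k) j))))
                  (proj₂ (proj₂ (ext j))))
          where
            eq′ : regionOf (h 0F) (h 1F) (h 2F) ≡ just R
            eq′ rewrite h≗g 0F | h≗g 1F | h≗g 2F = eq

    plan : (∀ v → v ∈ᴮ B) → ∃[ v ] v ∈ pos → ∃[ g ] Within X g × Determines pos neg g
    plan total (v , v∈pos) with locate (_∈? X) c T (total c)
    ... | absent none = contradiction (x∈p∪q⁺ (inj₁ v∈pos)) (none (total v))
    ... | self c∈X =
      anchored (just c) nothing nothing refl (vertexRegion-resolves G (k + k) c (proj₁ (total c) ↑ˡ k) {_∈ X}) refl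
        (just c∈X) nothing nothing
    ... | beside {x} {y} x∈ y∈ _ _ all c∉ =
      anchored (just x) (just y) nothing refl (blockRegion-resolves {P = B} {meet T x y} {_∈ X} all) (total c , c∉)
        (just x∈) (just y∈) nothing
    ... | between {x} {y} {z} x∈ y∈ z∈ _ _ _ c∈ all c∉ =
      anchored (just x) (just y) (just z) refl (blockRegion-resolves {P = towards T x z} {meet T x y} {_∈ X} all) (c∈ , c∉)
        (just x∈) (just y∈) (just z∈)

  plan-empty : ∀ {pos neg} → ¬ (∃[ v ] v ∈ pos) → Determines pos neg (λ _ → nothing)
  plan-empty empty h h≗nothing rewrite h≗nothing 0F =
    (λ v∈ → contradiction (_ , v∈) empty) , ∩≡⊥⁺ λ v∈⊥ → contradiction v∈⊥ ∉⊥

-- Compressing samples of balls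

module _ {n k : ℕ} {G : Graph n} {B : Block G k} (T : Tree B) (total : ∀ v → v ∈ᴮ B)
         (c₀ : Fin n) (w : ℕ) (fits : roles k < 2 ^ w) where

  -- A form of sample-hood decidable by finite search: the radius is below `n`, and samples without
  -- positive vertices are realized by the empty ball.
  Witness : (pos neg : Subset n) → Set
  Witness pos neg = ¬ (∃[ v ] v ∈ pos) ⊎ (∃[ c ] ∃[ r ] Realized G pos neg c r)

  witness? : ∀ pos neg → Dec (Witness pos neg)
  witness? pos neg = ¬? (nonempty? pos) ⊎-dec any? λ c → any? λ r →
    all? (λ v → v ∈? pos →-dec dist G c v ≤? toℕ r) ×-dec
    all? (λ v → v ∈? neg →-dec toℕ r <? dist G c v)

  sample⇒witness : ∀ {pos neg} → ∃[ e ] IsHyperedge (balls G) e × pos ⊆ e × neg ∩ e ≡ ⊥ → Witness pos neg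
  sample⇒witness {pos} {neg} (e , (c , r , isBall) , pos⊆e , neg∩e) with nonempty? pos
  ... | no empty = inj₁ empty
  ... | yes (v , v∈) with isBall-truncate G isBall (pos⊆e v∈)
  ...   | s , s<n , e⇔ = inj₂ (c , fromℕ< s<n ,
    subst (λ s → (∀ v → v ∈ pos → dist G c v ≤ s) × (∀ v → v ∈ neg → s < dist G c v))
      (sym (Fin.toℕ-fromℕ< s<n))
      ((λ v v∈ → to (e⇔ v) (pos⊆e v∈)) , (λ v v∈ → ≰⇒> λ d≤s → ∩≡⊥⁻ neg∩e v∈ (from (e⇔ v) d≤s))))

  witness⇒sample : ∀ {pos neg} → Witness pos neg → ∃[ e ] IsHyperedge (balls G) e × pos ⊆ e × neg ∩ e ≡ ⊥
  witness⇒sample (inj₁ empty) =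
    ⊥ , (c₀ , -[1+ 0 ] , ⊥-isBall G c₀) , (λ v∈ → contradiction (_ , v∈) empty) , ∩≡⊥⁺ λ _ → ∉⊥
  witness⇒sample (inj₂ (c , r , inside′ , outside′)) =
    ball G c (toℕ r) , (c , + toℕ r , ball-isBall G c (Fin.toℕ<n r)) ,
    (λ v∈ → ∈-subset⁺ (λ v → dist G c v ≤? toℕ r) (inside′ _ v∈)) ,
    ∩≡⊥⁺ λ v∈neg v∈ball → <⇒≱ (outside′ _ v∈neg) (∈-subset⁻ (λ v → dist G c v ≤? toℕ r) v∈ball)

  -- The proof stored in a sample is irrelevant and cannot be inspected, but decidability lets a
  -- centre and radius be found afresh.
  sampleWitness : ∀ S → Witness (pos S) (neg S)
  sampleWitness record { pos = p ; neg = q ; isSample = s } = recompute (witness? p q) (sample⇒witness s)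

  -- By irrelevance a sample is determined by its two sets, so searching all pairs of subsets is
  -- exhaustive.
  anySample? : {Q : Sample (balls G) → Set} → (∀ S → Dec (Q S)) → Dec (∃ Q)
  anySample? {Q} Q? = map′
    (λ (pos , neg , wit , q) → _ , q)
    (λ (S , q) → pos S , neg S , sampleWitness S , q)
    (anySubset? λ p → anySubset? λ q → check p q)
    where
      sample : ∀ p q → Witness p q → Sample (balls G)
      sample p q wit = record { pos = p ; neg = q ; isSample = witness⇒sample wit }

      check : ∀ p q → Dec (Σ (Witness p q) λ wit → Q (sample p q wit))
      check p q with witness? p q
      ... | no ¬wit = no λ (wit , _) → ¬wit wit
      ... | yes wit = map′ (wit ,_) proj₂ (Q? (sample p q wit))

  decode : Sample (balls G) × List Bool → Subset n
  decode (Y , bits) = reconstruct T (recall w (pos Y ∪ neg Y) bits)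

  restrict : Subset n → Sample (balls G) → Sample (balls G)
  restrict A record { pos = p ; neg = q ; isSample = s } =
    record { pos = A ∩ p ; neg = A ∩ q ; isSample = smaller s }
    where
      smaller : ∃[ e ] IsHyperedge (balls G) e × p ⊆ e × q ∩ e ≡ ⊥ →
                ∃[ e ] IsHyperedge (balls G) e × A ∩ p ⊆ e × (A ∩ q) ∩ e ≡ ⊥
      smaller (e , isHyperedge , p⊆e , q∩e) =
        e , isHyperedge , (λ v∈ → p⊆e (p∩q⊆q A p v∈)) , ∩≡⊥⁺ λ v∈ → ∩≡⊥⁻ q∩e (p∩q⊆q A q v∈)

  Compressed : Sample (balls G) → Set
  Compressed S = Σ (Sample (balls G) × List Bool) λ (Y , bits) →
    Subsample Y S × Realizes (decode (Y , bits)) S × size Y ≤ roles k × length bits ≡ roles k * w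

  store : ∀ S g → Within (pos S ∪ neg S) g → Determines T (pos S) (neg S) g → Compressed S
  store S g g∈ determines =
    let bits , len , recalled = memorise w (pos Y ∪ neg Y) (≤-<-trans size≤ fits) g kept in
    (Y , bits) ,
    (p∩q⊆q (range g) (pos S) , p∩q⊆q (range g) (neg S)) ,
    determines (recall w (pos Y ∪ neg Y) bits) recalled , size≤ , len
    where
      Y = restrict (range g) S

      size≤ : size Y ≤ roles k
      size≤ = ≤-trans (p⊆q⇒∣p∣≤∣q∣ within) (∣range∣≤ g)
        where
          within : pos Y ∪ neg Y ⊆ range g
          within v∈ with x∈p∪q⁻ (pos Y) (neg Y) v∈
          ... | inj₁ v∈pos = p∩q⊆p (range g) (pos S) v∈pos
          ... | inj₂ v∈neg = p∩q⊆p (range g) (neg S) v∈neg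

      kept : ∀ q {v} → g q ≡ just v → v ∈ pos Y ∪ neg Y
      kept q eq with x∈p∪q⁻ (pos S) (neg S) (g∈ q eq)
      ... | inj₁ v∈pos = x∈p∪q⁺ (inj₁ (x∈p∩q⁺ (∈-range g q eq , v∈pos)))
      ... | inj₂ v∈neg = x∈p∪q⁺ {p = pos Y} (inj₂ (x∈p∩q⁺ (∈-range g q eq , v∈neg)))

  compress : ∀ S → Compressed S
  compress S with nonempty? (pos S)
  ... | no empty = store S (λ _ → nothing) (λ _ ()) (plan-empty T empty)
  ... | yes v∈ with sampleWitness S
  ...   | inj₁ empty = contradiction v∈ empty
  ...   | inj₂ (c , r , realized) =
    let g , g∈ , determines = plan T realized total v∈ in store S g g∈ determines

  scheme : CompressionScheme (balls G)
  scheme = record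
    { κ           = proj₁ ∘ compress
    ; ρ           = decode
    ; κ-subsample = λ S → proj₁ (proj₂ (compress S))
    ; ρ-realizes  = λ S → proj₁ (proj₂ (proj₂ (compress S)))
    }

  scheme-proper : Proper scheme
  scheme-proper (Y , bits) = reconstruct-isBall T c₀ (recall w (pos Y ∪ neg Y) bits)

  -- All bit strings have the same length. The subsample size is only bounded, so its exact maximum
  -- is found by searching the finitely many samples.
  scheme-size : ∃[ s ] HasSize scheme s × s ≤ roles k + roles k * w
  scheme-size =
    let k₁ , k₁≤ , max = bounded⇒maximum (λ S → size (proj₁ (κ scheme S)))
                           (λ m → anySample? λ S → size (proj₁ (κ scheme S)) ≟ m)
                           empty (roles k) (λ S → proj₁ (proj₂ (proj₂ (proj₂ (compress S)))))
    in k₁ + roles k * w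
     , (k₁ , roles k * w , max , ((λ S → ≤-reflexive (length≡ S)) , empty , length≡ empty) , refl)
     , +-monoˡ-≤ (roles k * w) k₁≤
    where
      empty : Sample (balls G)
      empty = record { pos = ⊥ ; neg = ⊥ ; isSample = witness⇒sample (inj₁ λ (_ , v∈) → ∉⊥ v∈) }

      length≡ : ∀ S → length (proj₂ (κ scheme S)) ≡ roles k * w
      length≡ S = proj₂ (proj₂ (proj₂ (proj₂ (compress S))))

-- Numerical bounds and conclusion

someVertex : ∀ {k m} → Expr k m → Fin m
someVertex (single _)                = zero
someVertex (disjointUnion {n = n} e _) = someVertex e ↑ˡ n
someVertex (join _ _ _ e)            = someVertex e
someVertex (relabel _ _ e)           = someVertex e

n<2^1+⌊log₂n⌋ : ∀ n → n < 2 ^ suc ⌊log₂ n ⌋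
n<2^1+⌊log₂n⌋ = <-rec _ bound
  where
    bound : ∀ n → (∀ {m} → m < n → m < 2 ^ suc ⌊log₂ m ⌋) → n < 2 ^ suc ⌊log₂ n ⌋
    bound 0 _ = z<s
    bound 1 _ = s<s z<s
    bound n@(suc (suc m)) rec = begin-strict
      n                                     ≡⟨ ⌊n/2⌋+⌈n/2⌉≡n n ⟨
      ⌊ n /2⌋ + ⌈ n /2⌉                     ≤⟨ +-monoʳ-≤ ⌊ n /2⌋ (⌊n/2⌋-mono (n≤1+n (suc n))) ⟩
      ⌊ n /2⌋ + suc ⌊ n /2⌋                 <⟨ +-monoˡ-< (suc ⌊ n /2⌋) (n<1+n ⌊ n /2⌋) ⟩
      suc ⌊ n /2⌋ + suc ⌊ n /2⌋             ≤⟨ +-mono-≤ half half ⟩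
      2 ^ ⌊log₂ n ⌋ + 2 ^ ⌊log₂ n ⌋         ≡⟨ cong (λ m → 2 ^ ⌊log₂ n ⌋ + m) (+-identityʳ _) ⟨
      2 ^ suc ⌊log₂ n ⌋                     ∎
      where
        open ≤-Reasoning

        half : ⌊ n /2⌋ < 2 ^ ⌊log₂ n ⌋
        half = subst (λ l → ⌊ n /2⌋ < 2 ^ l)
          (trans (cong suc (⌊log₂⌊n/2⌋⌋≡⌊log₂n⌋∸1 n)) (m+[n∸m]≡n (⌊log₂⌋-mono-≤ {2} {n} (s≤s (s≤s z≤n)))))
          (rec (⌊n/2⌋<n (suc m)))

-- A code of this width has to name up to `roles k` kept vertices and one extra value for an empty
-- role, hence the strict inequality.
roles<2^ : ∀ t {k} → k ≤ t → roles k < 2 ^ (3 + ⌊log₂ suc t ⌋)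
roles<2^ t {k} k≤t = begin-strict
  3 + ((k + k) + (k + k))                   <⟨ +-mono-<-≤ (n<1+n 3) (+-mono-≤ (+-mono-≤ k≤t k≤t) (+-mono-≤ k≤t k≤t)) ⟩
  4 + ((t + t) + (t + t))                   ≡⟨ solve 1 (λ t → con 4 :+ ((t :+ t) :+ (t :+ t)) := con 4 :* (con 1 :+ t)) refl t ⟩
  4 * suc t                                 ≤⟨ *-monoʳ-≤ 4 (<⇒≤ (n<2^1+⌊log₂n⌋ (suc t))) ⟩
  4 * 2 ^ suc ⌊log₂ suc t ⌋                 ≡⟨ ^-distribˡ-+-* 2 2 (suc ⌊log₂ suc t ⌋) ⟨
  2 ^ (3 + ⌊log₂ suc t ⌋)                   ∎
  where open ≤-Reasoning

-- The constant is 7 times 5: `roles k` is at most `7 * t` as `t` is positive, and `4 + l` is at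
-- most `5 * l` as the logarithm `l` of `suc t` is at least 1.
size-bound : ∀ t {k} → 0 < t → k ≤ t →
             roles k + roles k * (3 + ⌊log₂ suc t ⌋) ≤ 35 * (t * ⌊log₂ suc t ⌋)
size-bound t {k} 0<t k≤t = begin
  roles k + roles k * (3 + l)               ≡⟨ *-suc (roles k) (3 + l) ⟨
  roles k * (4 + l)                         ≤⟨ *-mono-≤ roles≤ (+-monoˡ-≤ l (*-monoʳ-≤ 4 1≤l)) ⟩
  7 * t * (4 * l + l)                       ≡⟨ solve 2 (λ t l → con 7 :* t :* (con 4 :* l :+ l) := con 35 :* (t :* l)) refl t l ⟩
  35 * (t * l)                              ∎
  where
    open ≤-Reasoning
    l = ⌊log₂ suc t ⌋

    1≤l : 1 ≤ l
    1≤l = ⌊log₂⌋-mono-≤ {2} {suc t} (s≤s 0<t)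

    roles≤ : roles k ≤ 7 * t
    roles≤ = begin
      3 + ((k + k) + (k + k))               ≤⟨ +-mono-≤ (*-monoʳ-≤ 3 0<t) (+-mono-≤ (+-mono-≤ k≤t k≤t) (+-mono-≤ k≤t k≤t)) ⟩
      3 * t + ((t + t) + (t + t))           ≡⟨ solve 1 (λ t → con 3 :* t :+ ((t :+ t) :+ (t :+ t)) := con 7 :* t) refl t ⟩
      7 * t                                 ∎

theorem1p2 : ∃[ C ] 0 < C × (∀ t → 0 < t → ∀ n (G : Graph n) →
    (∃[ w ] IsCliquewidth G w × w ≤ t) →
    Σ (CompressionScheme (balls G)) λ 𝒞 →
    Proper 𝒞 × (∃[ s ] HasSize 𝒞 s × s ≤ C * (t * ⌊log₂ suc t ⌋)))
theorem1p2 = 35 , z<s , λ t 0<t n G (k , ((m , e , iso) , _) , k≤t) →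
  let d = iso⇒decomposition G e iso
      vs = _≅_.vertices iso
      -- The isomorphism is onto, so the root block contains every vertex of `G`.
      total = λ v → subst (_∈ᴮ Decomposition.block d) (Inverse.strictlyInverseˡ vs v)
                      (Decomposition.∈⁺ d (Inverse.from vs v))
      T = Decomposition.tree d
      c₀ = Inverse.to vs (someVertex e)
      fits = roles<2^ t k≤t
      s , hasSize , s≤ = scheme-size T total c₀ (3 + ⌊log₂ suc t ⌋) fits
  in scheme T total c₀ (3 + ⌊log₂ suc t ⌋) fits , scheme-proper T total c₀ (3 + ⌊log₂ suc t ⌋) fits , s , hasSize , ≤-trans s≤ (size-bound t 0<t k≤t)
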